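{- Let $T_5=\{(x,y)\in\mathbb{N}^2\mid x+y\le 6\}$. Then $\mathrm{gon}(R(T_5))=10$.
   Context: $\mathbb{N}=\{1,2,3,\dots\}$. For a finite set $F\subset\mathbb{N}^2$, the Ferrers rook graph $R(F)$ is the simple graph with vertex set $F$ in which distinct $(x,y),(x',y')$ are adjacent iff $x=x'$ or $y=y'$. Chip firing: firing a vertex sends one chip to each neighbor; divisors are equivalent if related by firings. An effective divisor $D$ has positive rank if for every vertex $v$ there is an effective divisor equivalent to $D$ with a positive number of chips at $v$. The gonality $\mathrm{gon}(G)$ is the minimum degree of an effective divisor of positive rank on $G$. -}

module Defs where

open import Data.Nat as ℕ using (ℕ; suc; _≤?_)
open import Data.Nat.Properties as ℕP using ()
open import Data.Integer as ℤ using (ℤ; +_; _+_; _-_; _≤_; _<_)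
open import Data.Fin using (Fin)
open import Data.Fin.Properties using (_≟_)
open import Data.List using (List; []; _∷_; length; filter; lookup; concatMap; upTo; map; foldr)
open import Data.List.Base using (allFin)
open import Data.Product using (_×_; _,_; Σ; ∃; proj₁; proj₂)
open import Data.Product.Properties using (≡-dec)
open import Data.Sum using (_⊎_)

open import Relation.Nullary using (¬_; Dec; yes; no)
open import Relation.Nullary.Decidable using (_×-dec_; _⊎-dec_; ¬?)
open import Relation.Binary.PropositionalEquality using (_≡_)
open import Relation.Binary.Construct.Closure.Equivalence using (EqClosure)

record Graph : Set₁ where
  field
    n    : ℕ
    Adj  : Fin n → Fin n → Set
    adj? : ∀ u v → Dec (Adj u v)

open Graph public

neighbours : (G : Graph) → Fin (n G) → List (Fin (n G))
neighbours G v = filter (adj? G v) (allFin (n G))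

deg : (G : Graph) → Fin (n G) → ℕ
deg G v = length (neighbours G v)

Divisor : Graph → Set
Divisor G = Fin (n G) → ℤ

fire : (G : Graph) → Fin (n G) → Divisor G → Divisor G
fire G v D w with w ≟ v
... | yes _ = D w - + deg G v
... | no _ with adj? G v w
...   | yes _ = D w + + 1
...   | no _  = D w

FiringStep : (G : Graph) → Divisor G → Divisor G → Set
FiringStep G D D' = ∃ λ v → ∀ w → D' w ≡ fire G v D w

Equivalent : (G : Graph) → Divisor G → Divisor G → Set
Equivalent G D D' = EqClosure (FiringStep G) D D'

Effective : (G : Graph) → Divisor G → Set
Effective G D = ∀ v → + 0 ≤ D v

degree : (G : Graph) → Divisor G → ℤ
degree G D = foldr (λ v acc → D v + acc) (+ 0) (allFin (n G))

PositiveRank : (G : Graph) → Divisor G → Set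
PositiveRank G D =
  Effective G D ×
  (∀ v → ∃ λ (D' : Divisor G) → Equivalent G D D' × Effective G D' × (+ 0 < D' v))

GonalityIs : Graph → ℕ → Set
GonalityIs G k =
  (∃ λ (D : Divisor G) → PositiveRank G D × degree G D ≡ + k) ×
  (∀ (D : Divisor G) → PositiveRank G D → + k ≤ degree G D)

-- Ferrers rook graphs.  A finite set F ⊂ ℕ² is given as a duplicate-free
-- list of points; the vertices are the entries of the list.

Point : Set
Point = ℕ × ℕ

RookAdj : Point → Point → Set
RookAdj (x , y) (x' , y') = ¬ ((x , y) ≡ (x' , y')) × (x ≡ x' ⊎ y ≡ y')

rookAdj? : ∀ p q → Dec (RookAdj p q)
rookAdj? (x , y) (x' , y') =
  ¬? (≡-dec ℕ._≟_ ℕ._≟_ (x , y) (x' , y')) ×-dec (x ℕ.≟ x' ⊎-dec y ℕ.≟ y')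

RookGraph : List Point → Graph
RookGraph F = record
  { n    = length F
  ; Adj  = λ i j → RookAdj (lookup F i) (lookup F j)
  ; adj? = λ i j → rookAdj? (lookup F i) (lookup F j)
  }

-- T₅ = {(x,y) ∈ ℕ² | x + y ≤ 6}, with ℕ = {1,2,3,...};
-- enumerated as x ∈ {1..5}, y ∈ {1..6-x} (each point exactly once).

T₅ : List Point
T₅ = concatMap (λ x → map (λ y → (x , y)) (range1 (6 ℕ.∸ x))) (range1 5)
  where
  range1 : ℕ → List ℕ
  range1 k = map suc (upTo k)

{-# OPTIONS --safe #-}
module Submission where

-- The diagonal x + y = 6 is independent, so one chip on each of the other ten vertices gives a
-- divisor of positive rank: un-firing a diagonal vertex moves chips onto it.
--
-- Conversely let D be effective of degree at most 9 and of positive rank.  If D is equivalent to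
-- an effective divisor D + L f, the set where f is maximal can be fired from D.  Firing sets that
-- avoid the corner (1,1) raises a bounded weight, so D may be taken such that every firable set
-- contains the corner.  Then each vertex w either has a chip or lies outside a firable set
-- containing the corner, and firing a set costs at least as many chips as its edge boundary has
-- edges.  Nine chips do not suffice for this unless the corner has 8 chips, as a short search over
-- lower bounds for D shows; in the remaining case fire the corner and search again.

open import Defs

open import Data.Bool using (Bool; true; false; if_then_else_; _∧_; _∨_; T)
open import Data.Bool.ListAction using (all)
open import Data.Bool.Properties using (T-∧; T-∨; ¬-not)
open import Data.Fin using (Fin; zero; suc)
open import Data.Fin.Properties using (_≟_; all?)
open import Data.Integer using (ℤ; +_; -_; _+_; _*_; _-_; _≤_; _<_; +≤+; +<+; nonNegative)
open import Data.Integer.Properties as ℤₚ using (module ≤-Reasoning)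
open import Data.Integer.Tactic.RingSolver using (solve-∀)
open import Data.List as List using (List; []; _∷_; allFin; length; filter; reverse)
open import Data.List.Extrema ℤₚ.≤-totalOrder using (argmax; f[xs]≤f[argmax])
open import Data.List.Membership.Propositional using (_∈_)
open import Data.List.Membership.Propositional.Properties using (∈-allFin)
open import Data.List.Relation.Unary.All as All using ()
open import Data.List.Relation.Unary.All.Properties using (all⁺)
open import Data.List.Relation.Unary.Any using (here)
open import Data.Maybe using (Maybe; just; nothing)
open import Data.Nat as ℕ using (ℕ; _⊔_; _<ᵇ_; _≤ᵇ_; z≤n; s≤s)
open import Data.Nat.Properties as ℕₚ using (≤ᵇ⇒≤; <ᵇ⇒<)
open import Data.Product using (_×_; _,_; ∃; proj₁; proj₂)
open import Data.Sum as Sum using (_⊎_; inj₁; inj₂; [_,_]′)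
open import Data.Unit using (tt)
open import Data.Vec as Vec using (Vec; []; _∷_; lookup; zipWith; _[_]≔_; replicate; tabulate)
open import Data.Vec.Properties using (lookup-zipWith; lookup∘update; lookup∘update′; lookup∘tabulate; lookup-replicate)
open import Function using (_∘_; id; case_of_; Equivalence; mk⇔)
open import Relation.Binary.Construct.Closure.ReflexiveTransitive using (ε; _◅_)
open import Relation.Binary.Construct.Closure.Symmetric using (fwd; bwd)
open import Relation.Binary.PropositionalEquality using (_≡_; _≢_; refl; sym; trans; cong; cong₂; subst; module ≡-Reasoning)
open import Relation.Nullary using (¬_; Dec; yes; no; does)
open import Relation.Nullary.Decidable using (does-⇔; dec-true; dec-false; from-yes; _×-dec_; _⊎-dec_; _→-dec_; ¬?)
open import Relation.Unary using (Decidable)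

open import Algebra.Properties.Semiring.Sum ℤₚ.+-*-semiring using (sum; sum-cong-≗; sum-replicate-zero; ∑-distrib-+; ∑-comm; *-distribˡ-sum; *-distribʳ-sum)

-- Finite sums of integers

sum-mono-≤ : ∀ {k} {f g : Fin k → ℤ} → (∀ i → f i ≤ g i) → sum f ≤ sum g
sum-mono-≤ {ℕ.zero}  f≤g = ℤₚ.≤-refl
sum-mono-≤ {ℕ.suc k} f≤g = ℤₚ.+-mono-≤ (f≤g zero) (sum-mono-≤ (f≤g ∘ suc))

sum-nonneg : ∀ {k} {f : Fin k → ℤ} → (∀ i → + 0 ≤ f i) → + 0 ≤ sum f
sum-nonneg {k} {f} 0≤f = subst (_≤ sum f) (sum-replicate-zero k) (sum-mono-≤ 0≤f)

term≤sum : ∀ {k} {f : Fin k → ℤ} → (∀ i → + 0 ≤ f i) → ∀ i → f i ≤ sum f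
term≤sum {f = f} 0≤f zero    =
  subst (_≤ sum f) (ℤₚ.+-identityʳ _) (ℤₚ.+-monoʳ-≤ (f zero) (sum-nonneg (0≤f ∘ suc)))
term≤sum {f = f} 0≤f (suc i) =
  subst (_≤ sum f) (ℤₚ.+-identityˡ _) (ℤₚ.+-mono-≤ (0≤f zero) (term≤sum (0≤f ∘ suc) i))

sum-neg : ∀ {k} (f : Fin k → ℤ) → sum (λ i → - f i) ≡ - sum f
sum-neg {ℕ.zero}  f = refl
sum-neg {ℕ.suc k} f =
  trans (cong (_+_ (- f zero)) (sum-neg (f ∘ suc))) (sym (ℤₚ.neg-distrib-+ (f zero) _))

δ : ∀ {k} → Fin k → Fin k → ℤ
δ v u = if does (u ≟ v) then + 1 else + 0

sum-δ : ∀ {k} (g : Fin k → ℤ) v → sum (λ u → g u * δ v u) ≡ g v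
sum-δ {ℕ.suc k} g zero = begin
  g zero * + 1 + sum (λ u → g (suc u) * + 0) ≡⟨ cong₂ _+_ (ℤₚ.*-identityʳ (g zero)) (sum-cong-≗ (λ u → ℤₚ.*-zeroʳ (g (suc u)))) ⟩
  g zero + sum {k} (λ _ → + 0)               ≡⟨ cong (_+_ (g zero)) (sum-replicate-zero k) ⟩
  g zero + + 0                               ≡⟨ ℤₚ.+-identityʳ _ ⟩
  g zero                                     ∎
  where open ≡-Reasoning
sum-δ {ℕ.suc k} g (suc v) =
  trans (cong₂ _+_ (ℤₚ.*-zeroʳ (g zero)) (sum-δ (g ∘ suc) v)) (ℤₚ.+-identityˡ _)

-- Turns degrees into sums: for `g = id` the filtered list is a neighbour list, as `allFin` is
-- `tabulate id`.
length-filter-tabulate : ∀ {k} {A : Set} {P : A → Set} (P? : Decidable P) (g : Fin k → A) →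
  + length (filter P? (List.tabulate g)) ≡ sum (λ i → + (if does (P? (g i)) then 1 else 0))
length-filter-tabulate {ℕ.zero}  P? g = refl
length-filter-tabulate {ℕ.suc k} P? g with does (P? (g zero))
... | true  = cong (_+_ (+ 1)) (length-filter-tabulate P? (g ∘ suc))
... | false = trans (length-filter-tabulate P? (g ∘ suc)) (sym (ℤₚ.+-identityˡ _))

-- A Boolean search over lower bounds for a divisor

module Search {n} (A : Vec (Vec ℕ n) n) (dead : Vec ℕ n → Bool) (seeds : List (Fin n)) where

  -- nothing marks a vertex whose membership is undecided.
  Partial : ℕ → Set
  Partial k = Vec (Maybe Bool) k

  excluded : ∀ {k} → Partial k → Vec ℕ k → ℕ
  excluded []               []       = 0
  excluded (just false ∷ p) (x ∷ xs) = x ℕ.+ excluded p xs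
  excluded (just true ∷ p)  (x ∷ xs) = excluded p xs
  excluded (nothing ∷ p)    (x ∷ xs) = excluded p xs

  ifMember : Maybe Bool → ℕ → ℕ
  ifMember (just true)  k = k
  ifMember (just false) k = 0
  ifMember nothing      k = 0

  -- What firing costs the decided members so far: only neighbours already decided to be outside are
  -- charged.
  demand : Partial n → Vec ℕ n
  demand p = zipWith (λ s row → ifMember s (excluded p row)) p A

  -- If `s` equals `w`, the second update overwrites the first; `refute` therefore skips that seed.
  start : Fin n → Fin n → Partial n
  start w s = replicate n nothing [ w ]≔ just false [ s ]≔ just true

  -- The vector m is a lower bound for a divisor.  For each w in turn, either w has a chip or
  -- some set containing a seed but not w can be fired; grow and split decide, one vertex at a
  -- time, which vertices belong to that set, raising m to what firing it demands.
  mutual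
    refute : List (Fin n) → Vec ℕ n → Bool
    refute []       m = false
    refute (w ∷ ws) m with lookup m w
    ... | ℕ.suc _ = refute ws m
    ... | ℕ.zero  = (dead (m [ w ]≔ 1) ∨ refute ws (m [ w ]≔ 1))
                  ∧ all (λ s → does (s ≟ w) ∨ grow ws (allFin n) m (start w s)) seeds

    grow : List (Fin n) → List (Fin n) → Vec ℕ n → Partial n → Bool
    grow ws vs m p = dead m′ ∨ split ws vs m′ p
      where m′ = zipWith _⊔_ m (demand p)

    split : List (Fin n) → List (Fin n) → Vec ℕ n → Partial n → Bool
    split ws []       m p = refute ws m
    split ws (v ∷ vs) m p with lookup p v
    ... | just _  = split ws vs m p
    ... | nothing = grow ws vs m (p [ v ]≔ just true) ∧ grow ws vs m (p [ v ]≔ just false)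

-- The graph Laplacian and equivalence of divisors

module Laplacian (G : Graph) (Adj-sym : ∀ {u v} → Adj G u v → Adj G v u)
                 (Adj-irrefl : ∀ {v} → ¬ Adj G v v) where

  V : Set
  V = Fin (n G)

  χ : V → V → ℕ
  χ u v = if does (adj? G u v) then 1 else 0

  χ-sym : ∀ u v → χ u v ≡ χ v u
  χ-sym u v = cong (if_then 1 else 0) (does-⇔ (mk⇔ Adj-sym Adj-sym) (adj? G u v) (adj? G v u))

  -- The negative of the usual Laplacian: the change at `w` when every vertex `u` is fired `f u`
  -- times.
  lap : (V → ℤ) → V → ℤ
  lap f w = sum (λ u → + χ w u * (f u - f w))

  lap-expand : ∀ f w → lap f w ≡ sum (λ u → + χ w u * f u) + + deg G w * (- f w)
  lap-expand f w = begin
    lap f w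
      ≡⟨ sum-cong-≗ (λ u → ℤₚ.*-distribˡ-+ (+ χ w u) (f u) (- f w)) ⟩
    sum (λ u → + χ w u * f u + + χ w u * (- f w))
      ≡⟨ ∑-distrib-+ _ (λ u → + χ w u * (- f w)) ⟩
    sum (λ u → + χ w u * f u) + sum (λ u → + χ w u * (- f w))
      ≡⟨ cong (_+_ (sum (λ u → + χ w u * f u))) (sym (*-distribʳ-sum (- f w) (λ u → + χ w u))) ⟩
    sum (λ u → + χ w u * f u) + sum (λ u → + χ w u) * (- f w)
      ≡⟨ cong (λ d → sum (λ u → + χ w u * f u) + d * (- f w)) (sym (length-filter-tabulate (adj? G w) id)) ⟩
    sum (λ u → + χ w u * f u) + + deg G w * (- f w) ∎
    where open ≡-Reasoning

  lap-+ : ∀ f g w → lap (λ u → f u + g u) w ≡ lap f w + lap g w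
  lap-+ f g w = trans (sum-cong-≗ (λ u → rearrange (+ χ w u) (f u) (g u) (f w) (g w)))
    (∑-distrib-+ (λ u → + χ w u * (f u - f w)) (λ u → + χ w u * (g u - g w)))
    where
    rearrange : ∀ c a b a′ b′ → c * ((a + b) - (a′ + b′)) ≡ c * (a - a′) + c * (b - b′)
    rearrange = solve-∀

  lap-neg : ∀ f w → lap (λ u → - f u) w ≡ - lap f w
  lap-neg f w = trans (sum-cong-≗ (λ u → rearrange (+ χ w u) (f u) (f w))) (sum-neg (λ u → + χ w u * (f u - f w)))
    where
    rearrange : ∀ c a a′ → c * (- a - - a′) ≡ - (c * (a - a′))
    rearrange = solve-∀

  lap-const : ∀ c w → lap (λ _ → c) w ≡ + 0
  lap-const c w = trans (sum-cong-≗ (λ u → vanish (+ χ w u) c)) (sum-replicate-zero (n G))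
    where
    vanish : ∀ x c → x * (c - c) ≡ + 0
    vanish = solve-∀

  -- The adjacency part `X` is symmetric because `χ` is, after exchanging the sums; the degree part
  -- `Y` is diagonal.
  lap-selfAdjoint : ∀ h f → sum (λ w → h w * lap f w) ≡ sum (λ w → f w * lap h w)
  lap-selfAdjoint h f = begin
    sum (λ w → h w * lap f w)                                ≡⟨ expand h f ⟩
    sum (λ w → sum (X h f w)) + sum (Y h f)                  ≡⟨ cong₂ _+_ swap (sum-cong-≗ (λ w → swap-Y (h w) (+ deg G w) (f w))) ⟩
    sum (λ w → sum (X f h w)) + sum (Y f h)                  ≡⟨ expand f h ⟨
    sum (λ w → f w * lap h w)                                ∎
    where
    open ≡-Reasoning
    X : (V → ℤ) → (V → ℤ) → V → V → ℤ
    X h f w u = (+ χ w u * f u) * h w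
    Y : (V → ℤ) → (V → ℤ) → V → ℤ
    Y h f w = h w * (+ deg G w * (- f w))
    swap-Y : ∀ h d f → h * (d * (- f)) ≡ f * (d * (- h))
    swap-Y = solve-∀
    swap-X : ∀ c h f → (c * f) * h ≡ (c * h) * f
    swap-X = solve-∀
    expand : ∀ h f → sum (λ w → h w * lap f w) ≡ sum (λ w → sum (X h f w)) + sum (Y h f)
    expand h f = trans (sum-cong-≗ λ w → begin
      h w * lap f w                                        ≡⟨ cong (h w *_) (lap-expand f w) ⟩
      h w * (sum (λ u → + χ w u * f u) + + deg G w * (- f w)) ≡⟨ ℤₚ.*-distribˡ-+ (h w) (sum (λ u → + χ w u * f u)) _ ⟩
      h w * sum (λ u → + χ w u * f u) + Y h f w            ≡⟨ cong (_+ Y h f w) (ℤₚ.*-comm (h w) _) ⟩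
      sum (λ u → + χ w u * f u) * h w + Y h f w            ≡⟨ cong (_+ Y h f w) (*-distribʳ-sum (h w) (λ u → + χ w u * f u)) ⟩
      sum (X h f w) + Y h f w                              ∎)
      (∑-distrib-+ (λ w → sum (X h f w)) (Y h f))
    swap : sum (λ w → sum (X h f w)) ≡ sum (λ w → sum (X f h w))
    swap = trans (∑-comm (X h f)) (sum-cong-≗ λ u → sum-cong-≗ λ w →
      trans (swap-X (+ χ w u) (h w) (f u)) (cong (λ c → (+ c * h w) * f u) (χ-sym w u)))

  χ-irrefl : ∀ v → χ v v ≡ 0
  χ-irrefl v = cong (if_then 1 else 0) (dec-false (adj? G v v) Adj-irrefl)

  lap-δ : ∀ v w → lap (δ v) w ≡ + χ w v + + deg G w * (- δ v w)
  lap-δ v w = trans (lap-expand (δ v) w) (cong (_+ + deg G w * (- δ v w)) (sum-δ (λ u → + χ w u) v))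

  lap-δ-at : ∀ v → lap (δ v) v ≡ - + deg G v
  lap-δ-at v rewrite lap-δ v v | χ-irrefl v | dec-true (v ≟ v) refl = simplify (+ deg G v)
    where
    simplify : ∀ d → + 0 + d * (- + 1) ≡ - d
    simplify = solve-∀

  lap-δ-off : ∀ {v w} → w ≢ v → lap (δ v) w ≡ + χ v w
  lap-δ-off {v} {w} w≢v rewrite lap-δ v w | χ-sym w v | dec-false (w ≟ v) w≢v | ℤₚ.*-zeroʳ (+ deg G w) =
    ℤₚ.+-identityʳ (+ χ v w)

  fire-lap : ∀ v D w → fire G v D w ≡ D w + lap (δ v) w
  -- `lap (δ v) w` itself contains `w ≟ v`; replacing it by a variable `x` keeps the case split in
  -- `cases` away from it.
  fire-lap v D w = cases (λ { refl → lap-δ-at v }) lap-δ-off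
    where
    cases : ∀ {x} → (w ≡ v → x ≡ - + deg G v) → (w ≢ v → x ≡ + χ v w) → fire G v D w ≡ D w + x
    cases at off with w ≟ v
    ... | yes w≡v rewrite at w≡v = refl
    ... | no w≢v  rewrite off w≢v with adj? G v w
    ...   | yes _ = refl
    ...   | no _  = sym (ℤₚ.+-identityʳ (D w))

  unfire : V → Divisor G → Divisor G
  unfire v D w = D w - lap (δ v) w

  unfire-equivalent : ∀ v D → Equivalent G D (unfire v D)
  unfire-equivalent v D = bwd (v , λ w →
    trans (cancel (D w) (lap (δ v) w)) (sym (fire-lap v (unfire v D) w))) ◅ ε
    where
    cancel : ∀ d l → d ≡ (d - l) + l
    cancel = solve-∀

  -- `f` counts the net firings of each vertex along the chain; a backward step counts as minus one.
  equivalent⇒lap : ∀ {D D′} → Equivalent G D D′ → ∃ λ f → ∀ w → D′ w ≡ D w + lap f w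
  equivalent⇒lap {D} ε = (λ _ → + 0) , λ w →
    sym (trans (cong (_+_ (D w)) (lap-const (+ 0) w)) (ℤₚ.+-identityʳ (D w)))
  equivalent⇒lap {D} (_◅_ {j = D₁} (fwd (v , D₁≡)) rest) with equivalent⇒lap rest
  ... | f , D′≡ = (λ u → δ v u + f u) , λ w → trans (D′≡ w) (begin
    D₁ w + lap f w                    ≡⟨ cong (_+ lap f w) (trans (D₁≡ w) (fire-lap v D w)) ⟩
    D w + lap (δ v) w + lap f w       ≡⟨ ℤₚ.+-assoc (D w) _ _ ⟩
    D w + (lap (δ v) w + lap f w)     ≡⟨ cong (_+_ (D w)) (lap-+ (δ v) f w) ⟨
    D w + lap (λ u → δ v u + f u) w   ∎)
    where open ≡-Reasoning
  equivalent⇒lap {D} (_◅_ {j = D₁} (bwd (v , D≡)) rest) with equivalent⇒lap rest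
  ... | f , D′≡ = (λ u → - δ v u + f u) , λ w → trans (D′≡ w) (begin
    D₁ w + lap f w                                      ≡⟨ rearrange (D₁ w) (lap (δ v) w) (lap f w) ⟩
    (D₁ w + lap (δ v) w) + (- lap (δ v) w + lap f w)    ≡⟨ cong₂ _+_ (trans (D≡ w) (fire-lap v D₁ w))
                                                            (trans (lap-+ (λ u → - δ v u) f w) (cong (_+ lap f w) (lap-neg (δ v) w))) ⟨
    D w + lap (λ u → - δ v u + f u) w                   ∎)
    where
    open ≡-Reasoning
    rearrange : ∀ d l k → d + k ≡ (d + l) + (- l + k)
    rearrange = solve-∀

  _⊕_ : Divisor G → (V → ℤ) → Divisor G
  (D ⊕ f) w = D w + lap f w

  -- The reachability half of positive rank, phrased with firing counts so that it passes to
  -- equivalent divisors.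
  Reaches : Divisor G → Set
  Reaches D = ∀ w → ∃ λ f → Effective G (D ⊕ f) × + 0 < (D ⊕ f) w

  positiveRank⇒reaches : ∀ {D} → PositiveRank G D → Reaches D
  positiveRank⇒reaches (_ , reach) w with reach w
  ... | D′ , D∼D′ , eff , pos with equivalent⇒lap D∼D′
  ...   | f , D′≡ = f , (λ u → subst (+ 0 ≤_) (D′≡ u) (eff u)) , subst (+ 0 <_) (D′≡ w) pos

  reaches-⊕ : ∀ D g → Reaches D → Reaches (D ⊕ g)
  reaches-⊕ D g reach w with reach w
  ... | f , eff , pos = (λ u → f u + - g u) ,
      (λ u → subst (+ 0 ≤_) (shift u) (eff u)) , subst (+ 0 <_) (shift w) pos
    where
    rearrange : ∀ d l k → d + k ≡ (d + l) + (k + - l)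
    rearrange = solve-∀
    shift : ∀ u → (D ⊕ f) u ≡ ((D ⊕ g) ⊕ (λ v → f v + - g v)) u
    shift u = trans (rearrange (D u) (lap g u) (lap f u)) (cong (_+_ ((D ⊕ g) u))
      (sym (trans (lap-+ f (λ v → - g v) u) (cong (_+_ (lap f u)) (lap-neg g u)))))

  weight : (V → ℤ) → Divisor G → ℤ
  weight h D = sum (λ w → h w * D w)

  -- Self-adjointness moves the Laplacian onto `h`, so the sign of `lap h` decides whether firing
  -- gains weight.
  weight-⊕ : ∀ h D f → weight h (D ⊕ f) ≡ weight h D + sum (λ w → f w * lap h w)
  weight-⊕ h D f = trans (sum-cong-≗ λ w → ℤₚ.*-distribˡ-+ (h w) (D w) (lap f w))
    (trans (∑-distrib-+ (λ w → h w * D w) (λ w → h w * lap f w)) (cong (_+_ (weight h D)) (lap-selfAdjoint h f)))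

  -- The degree is the weight for the constant function one, whose Laplacian vanishes.
  sum-⊕ : ∀ D f → sum (D ⊕ f) ≡ sum D
  sum-⊕ D f = begin
    sum (D ⊕ f)                                       ≡⟨ sum-cong-≗ (λ w → ℤₚ.*-identityˡ ((D ⊕ f) w)) ⟨
    weight (λ _ → + 1) (D ⊕ f)                        ≡⟨ weight-⊕ (λ _ → + 1) D f ⟩
    weight (λ _ → + 1) D + sum (λ w → f w * lap (λ _ → + 1) w)
      ≡⟨ cong₂ _+_ (sum-cong-≗ λ w → ℤₚ.*-identityˡ (D w))
           (sum-cong-≗ λ w → trans (cong (f w *_) (lap-const (+ 1) w)) (ℤₚ.*-zeroʳ (f w))) ⟩
    sum D + sum {n G} (λ _ → + 0)                     ≡⟨ cong (_+_ (sum D)) (sum-replicate-zero (n G)) ⟩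
    sum D + + 0                                       ≡⟨ ℤₚ.+-identityʳ _ ⟩
    sum D                                             ∎
    where open ≡-Reasoning

  -- Firing sets of vertices

  outdeg : (V → Bool) → V → ℤ
  outdeg U w = sum (λ v → if U v then + 0 else + χ w v)

  Firable : Divisor G → (V → Bool) → Set
  Firable D U = ∀ w → U w ≡ true → outdeg U w ≤ D w

  indicator : (V → Bool) → V → ℤ
  indicator U v = if U v then + 1 else + 0

  -- A member of `U` loses exactly its outdegree, and a vertex outside `U` can only gain.
  fire-effective : ∀ D U → Effective G D → Firable D U → Effective G (D ⊕ indicator U)
  fire-effective D U eff fir w with U w in Uw
  ... | true  = subst (+ 0 ≤_) (cong (_+_ (D w)) (sym lap≡)) (ℤₚ.i≤j⇒0≤j-i (fir w Uw))
    where
    term : ∀ v → + χ w v * (indicator U v - + 1) ≡ - (if U v then + 0 else + χ w v)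
    term v with U v
    ... | true  = ℤₚ.*-zeroʳ (+ χ w v)
    ... | false = trans (ℤₚ.*-comm (+ χ w v) _) (ℤₚ.-1*i≡-i (+ χ w v))
    lap≡ : sum (λ v → + χ w v * (indicator U v - + 1)) ≡ - outdeg U w
    lap≡ = trans (sum-cong-≗ term) (sum-neg (λ v → if U v then + 0 else + χ w v))
  ... | false = ℤₚ.+-mono-≤ (eff w) (sum-nonneg term)
    where
    term : ∀ v → + 0 ≤ + χ w v * (indicator U v - + 0)
    term v with U v
    ... | true  = subst (+ 0 ≤_) (sym (ℤₚ.*-identityʳ (+ χ w v))) (+≤+ z≤n)
    ... | false = subst (+ 0 ≤_) (sym (ℤₚ.*-zeroʳ (+ χ w v))) (+≤+ z≤n)

  ⟨_⟩ : V → V → Bool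
  ⟨ v ⟩ u = does (u ≟ v)

  firable-⟨⟩ : ∀ D v → + deg G v ≤ D v → Firable D ⟨ v ⟩
  firable-⟨⟩ D v deg≤ w eq with w ≟ v
  ... | yes refl = ℤₚ.≤-trans (sum-mono-≤ term) (subst (_≤ D w) (length-filter-tabulate (adj? G w) id) deg≤)
    where
    term : ∀ u → (if ⟨ w ⟩ u then + 0 else + χ w u) ≤ + χ w u
    term u with ⟨ w ⟩ u
    ... | true  = +≤+ z≤n
    ... | false = ℤₚ.≤-refl

  -- The vertices where f is maximal can be fired, and gain no chips in passing from D to D ⊕ f.
  reaches⇒firable : ∀ D → Reaches D → ∀ w →
    + 0 < D w ⊎ ∃ λ U → U w ≡ false × Firable D U × ∃ λ u → U u ≡ true
  reaches⇒firable D reach w with reach w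
  ... | f , eff , pos = answer
    where
    top : V
    top = argmax f w (allFin (n G))
    f≤top : ∀ v → f v ≤ f top
    f≤top v = All.lookup (f[xs]≤f[argmax] {f = f} w (allFin (n G))) (∈-allFin v)
    U : V → Bool
    U v = does (f top ℤₚ.≤? f v)
    U⇒top≤ : ∀ v → U v ≡ true → f top ≤ f v
    U⇒top≤ v eq with f top ℤₚ.≤? f v
    U⇒top≤ v eq | yes le = le
    lap≤ : ∀ v → U v ≡ true → lap f v ≤ - outdeg U v
    lap≤ v Uv = subst (lap f v ≤_) (sum-neg (λ u → if U u then + 0 else + χ v u)) (sum-mono-≤ term)
      where
      term : ∀ u → + χ v u * (f u - f v) ≤ - (if U u then + 0 else + χ v u)
      term u with f top ℤₚ.≤? f u
      ... | yes _ = begin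
        + χ v u * (f u - f v) ≤⟨ ℤₚ.*-monoˡ-≤-nonNeg (+ χ v u) (ℤₚ.i≤j⇒i-j≤0 (ℤₚ.≤-trans (f≤top u) (U⇒top≤ v Uv))) ⟩
        + χ v u * + 0         ≡⟨ ℤₚ.*-zeroʳ (+ χ v u) ⟩
        + 0                   ∎
        where open ≤-Reasoning
      ... | no top≰ = begin
        + χ v u * (f u - f v) ≤⟨ ℤₚ.*-monoˡ-≤-nonNeg (+ χ v u) below ⟩
        + χ v u * (- + 1)     ≡⟨ trans (ℤₚ.*-comm (+ χ v u) _) (ℤₚ.-1*i≡-i (+ χ v u)) ⟩
        - + χ v u             ∎
        where
        open ≤-Reasoning
        rearrange : ∀ a b → a - b ≡ - + 1 + ((+ 1 + a) - b)
        rearrange = solve-∀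
        -- Integrality: off the maximum, `f` is lower by at least one, so every edge leaving `U`
        -- costs a chip.
        below : f u - f v ≤ - + 1
        below = begin
          f u - f v                     ≡⟨ rearrange (f u) (f v) ⟩
          - + 1 + ((+ 1 + f u) - f v)   ≤⟨ ℤₚ.+-monoʳ-≤ (- + 1) (ℤₚ.i≤j⇒i-j≤0
                                            (ℤₚ.≤-trans (ℤₚ.i<j⇒suc[i]≤j (ℤₚ.≰⇒> top≰)) (U⇒top≤ v Uv))) ⟩
          - + 1                         ∎
    firable : Firable D U
    firable v Uv = ℤₚ.0≤i-j⇒j≤i (ℤₚ.≤-trans (eff v) (ℤₚ.+-monoʳ-≤ (D v) (lap≤ v Uv)))
    outdeg-nonneg : ∀ v → + 0 ≤ outdeg U v
    outdeg-nonneg v = sum-nonneg λ u → nn u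
      where
      nn : ∀ u → + 0 ≤ (if U u then + 0 else + χ v u)
      nn u with U u
      ... | true  = ℤₚ.≤-refl
      ... | false = +≤+ z≤n
    answer : + 0 < D w ⊎ ∃ λ U → U w ≡ false × Firable D U × ∃ λ u → U u ≡ true
    answer with U w in Uw
    ... | true  = inj₁ (ℤₚ.<-≤-trans pos (subst ((D ⊕ f) w ≤_) (ℤₚ.+-identityʳ (D w))
                    (ℤₚ.+-monoʳ-≤ (D w) (ℤₚ.≤-trans (lap≤ w Uw) (ℤₚ.neg-mono-≤ (outdeg-nonneg w))))))
    ... | false = inj₂ (U , Uw , firable , top , dec-true (f top ℤₚ.≤? f top) ℤₚ.≤-refl)

  -- Soundness of the search

  Covered : List V → Divisor G → Set
  Covered seeds D = ∀ w → + 0 < D w ⊎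
    ∃ λ U → U w ≡ false × Firable D U × ∃ λ s → s ∈ seeds × U s ≡ true

  -- The seeds are vertices of which every nonempty firable set contains one: the corner for a
  -- reduced divisor, all vertices in general.
  reaches⇒covered : ∀ D seeds → Reaches D →
    (∀ U u → Firable D U → U u ≡ true → ∃ λ s → s ∈ seeds × U s ≡ true) → Covered seeds D
  reaches⇒covered D seeds reach seeded w = Sum.map₂
    (λ { (U , Uw , fir , u , Uu) → U , Uw , fir , seeded U u fir Uu }) (reaches⇒firable D reach w)

  adjacency : Vec (Vec ℕ (n G)) (n G)
  adjacency = tabulate (λ w → tabulate (χ w))

  infix 4 _≼_
  _≼_ : ∀ {k} → Vec ℕ k → (Fin k → ℤ) → Set
  m ≼ D = ∀ i → + lookup m i ≤ D i

  ≼-sum : ∀ {k} (m : Vec ℕ k) {D} → m ≼ D → + Vec.sum m ≤ sum D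
  ≼-sum []      m≼D = ℤₚ.≤-refl
  ≼-sum (x ∷ m) m≼D = ℤₚ.+-mono-≤ (m≼D zero) (≼-sum m (m≼D ∘ suc))

  ≼-⊔ : ∀ {k} (m m′ : Vec ℕ k) {D} → m ≼ D → m′ ≼ D → zipWith _⊔_ m m′ ≼ D
  ≼-⊔ m m′ {D} m≼D m′≼D i rewrite lookup-zipWith _⊔_ i m m′
    with ℕₚ.⊔-sel (lookup m i) (lookup m′ i)
  ... | inj₁ eq rewrite eq = m≼D i
  ... | inj₂ eq rewrite eq = m′≼D i

  ≼-update : ∀ {k} (m : Vec ℕ k) {D x} w → m ≼ D → + x ≤ D w → m [ w ]≔ x ≼ D
  ≼-update m {x = x} w m≼D x≤ i with i ≟ w
  ... | yes refl rewrite lookup∘update i m x       = x≤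
  ... | no  i≢w  rewrite lookup∘update′ i≢w m x = m≼D i

  -- Provides the initial bound for a search that begins just after `v` has been fired.
  neighbours≼ : ∀ D v → Effective G D → Effective G (D ⊕ δ v) → tabulate (χ v) ≼ D ⊕ δ v
  neighbours≼ D v eff eff′ w =
    subst (λ x → + x ≤ (D ⊕ δ v) w) (sym (lookup∘tabulate (χ v) w)) (cases (w ≟ v))
    where
    cases : Dec (w ≡ v) → + χ v w ≤ (D ⊕ δ v) w
    cases (yes refl) = subst (λ x → + x ≤ (D ⊕ δ v) w) (sym (χ-irrefl w)) (eff′ w)
    cases (no w≢v)   = subst (λ x → + χ v w ≤ D w + x) (sym (lap-δ-off w≢v))
      (ℤₚ.+-mono-≤ {x = + 0} (eff w) ℤₚ.≤-refl)

  Refines : ∀ {k} → (Fin k → Bool) → Vec (Maybe Bool) k → Set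
  Refines U p = ∀ i {b} → lookup p i ≡ just b → U i ≡ b

  refines-update : ∀ {k} (p : Vec (Maybe Bool) k) {U b} v → Refines U p → U v ≡ b →
    Refines U (p [ v ]≔ just b)
  refines-update p {b = b} v ref Uv i eq with i ≟ v
  ... | yes refl rewrite lookup∘update i p (just b) with refl ← eq = Uv
  ... | no  i≢v  rewrite lookup∘update′ i≢v p (just b) = ref i eq

  module Soundness (dead : Vec ℕ (n G) → Bool) (seeds : List V)
    (D : Divisor G) (eff : Effective G D) (alive : ∀ m → m ≼ D → ¬ T (dead m))
    (covered : Covered seeds D) where

    open Search adjacency dead seeds

    -- An undecided vertex counts zero on the left and a nonnegative amount on the right.
    excluded≤ : ∀ {k} (p : Partial k) (g : Fin k → ℕ) U → Refines U p →
      + excluded p (tabulate g) ≤ sum (λ v → if U v then + 0 else + g v)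
    excluded≤ []      g U ref = ℤₚ.≤-refl
    excluded≤ (b ∷ p) g U ref with excluded≤ p (g ∘ suc) (U ∘ suc) (ref ∘ suc)
    excluded≤ (just false ∷ p) g U ref | ih rewrite ref zero refl = ℤₚ.+-monoʳ-≤ (+ g zero) ih
    excluded≤ (just true ∷ p)  g U ref | ih rewrite ref zero refl = ℤₚ.+-monoʳ-≤ (+ 0) ih
    excluded≤ (nothing ∷ p)    g U ref | ih with U zero
    ... | true  = ℤₚ.+-monoʳ-≤ (+ 0) ih
    ... | false = ℤₚ.+-mono-≤ {x = + 0} {y = + g zero} (+≤+ z≤n) ih

    demand≼ : ∀ p {U} → Firable D U → Refines U p → demand p ≼ D
    demand≼ p {U} fir ref i
      rewrite lookup-zipWith (λ s row → ifMember s (excluded p row)) i p adjacency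
            | lookup∘tabulate (λ w → tabulate (χ w)) i
      with lookup p i in eq
    ... | just true  = ℤₚ.≤-trans (excluded≤ p (χ i) U ref) (fir i (ref i eq))
    ... | just false = eff i
    ... | nothing    = eff i

    start-refines : ∀ {U} w s → U w ≡ false → U s ≡ true → Refines U (start w s)
    start-refines w s Uw Us = refines-update (replicate _ nothing [ w ]≔ just false) s
      (refines-update (replicate _ nothing) w undecided Uw) Us
      where
      undecided : Refines _ (replicate (n G) nothing)
      undecided i eq rewrite lookup-replicate i (nothing {A = Bool}) with () ← eq

    mutual
      -- `D` picks a branch at every split: `covered w` chooses a chip or a set, and that set
      -- answers each membership question. A successful refutation would thus reach a dead bound for
      -- `D`, against `alive`.
      refute-sound : ∀ ws m → m ≼ D → ¬ T (refute ws m)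
      refute-sound (w ∷ ws) m m≼D t with lookup m w
      ... | ℕ.suc _ = refute-sound ws m m≼D t
      ... | ℕ.zero  with Equivalence.to T-∧ t | covered w
      ...   | t₁ , _ | inj₁ 0<Dw =
        [ alive _ m′≼D , refute-sound ws _ m′≼D ]′ (Equivalence.to T-∨ t₁)
        where m′≼D = ≼-update m w m≼D (ℤₚ.i<j⇒suc[i]≤j 0<Dw)
      ...   | _ , t₂ | inj₂ (U , Uw , fir , s , s∈ , Us)
        with Equivalence.to (T-∨ {does (s ≟ w)}) (All.lookup (all⁺ _ seeds t₂) s∈)
      ...     | inj₂ t₃ = grow-sound ws (allFin _) m (start w s) m≼D fir (start-refines w s Uw Us) t₃
      ...     | inj₁ t₃ = subst T (dec-false (s ≟ w) λ { refl → case trans (sym Us) Uw of λ () }) t₃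

      grow-sound : ∀ ws vs m p {U} → m ≼ D → Firable D U → Refines U p → ¬ T (grow ws vs m p)
      grow-sound ws vs m p m≼D fir ref t =
        [ alive _ m′≼D , split-sound ws vs _ p m′≼D fir ref ]′ (Equivalence.to T-∨ t)
        where m′≼D = ≼-⊔ m (demand p) m≼D (demand≼ p fir ref)

      split-sound : ∀ ws vs m p {U} → m ≼ D → Firable D U → Refines U p → ¬ T (split ws vs m p)
      -- With all memberships decided, the set is forgotten; only the raised bound `m` goes on to
      -- the next vertex.
      split-sound ws []       m p m≼D fir ref t = refute-sound ws m m≼D t
      split-sound ws (v ∷ vs) m p {U} m≼D fir ref t with lookup p v
      ... | just _  = split-sound ws vs m p m≼D fir ref t
      ... | nothing with Equivalence.to (T-∧ {grow ws vs m (p [ v ]≔ just true)}) t | U v in Uv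
      ...   | t₁ , _ | true  = grow-sound ws vs m (p [ v ]≔ just true) m≼D fir (refines-update p v ref Uv) t₁
      ...   | _ , t₂ | false = grow-sound ws vs m (p [ v ]≔ just false) m≼D fir (refines-update p v ref Uv) t₂

-- The rook graph of `T₅` and the lower bound

rook-sym : ∀ p q → RookAdj p q → RookAdj q p
rook-sym _ _ (p≢q , inj₁ x≡) = p≢q ∘ sym , inj₁ (sym x≡)
rook-sym _ _ (p≢q , inj₂ y≡) = p≢q ∘ sym , inj₂ (sym y≡)

G₅ : Graph
G₅ = RookGraph T₅

open Laplacian G₅ (λ {u} {v} → rook-sym (List.lookup T₅ u) (List.lookup T₅ v)) (λ adj → proj₁ adj refl)

-- The point (1,1), first in the enumeration, with eight neighbours.
corner : V
corner = zero

-- Chosen to be strictly subharmonic away from the corner, so that firing a set avoiding the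
-- corner raises the weight.
h : V → ℤ
h v = if does (v ≟ corner) then + 5 else + χ corner v

-- The tight case is (1,2): the corner contributes 5 - 1 and the three points (2,2), (3,2), (4,2)
-- contribute -1 each. This is the source of the value 5.
h-subharmonic : ∀ w → w ≢ corner → + 1 ≤ lap h w
h-subharmonic = from-yes (all? λ w → ¬? (w ≟ corner) →-dec + 1 ℤₚ.≤? lap h w)

h≤5 : ∀ w → h w ≤ + 5
h≤5 = from-yes (all? λ w → h w ℤₚ.≤? + 5)

weight≤45 : ∀ D → Effective G₅ D → sum D ≤ + 9 → weight h D ≤ + 45
weight≤45 D eff deg≤9 = begin
  weight h D             ≤⟨ sum-mono-≤ (λ w → ℤₚ.*-monoʳ-≤-nonNeg (D w) {{nonNegative (eff w)}} (h≤5 w)) ⟩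
  sum (λ w → + 5 * D w)  ≡⟨ *-distribˡ-sum (+ 5) D ⟨
  + 5 * sum D            ≤⟨ ℤₚ.*-monoˡ-≤-nonNeg (+ 5) deg≤9 ⟩
  + 45                   ∎
  where open ≤-Reasoning

-- The gain is the sum of `lap h` over `U`, where every term is at least one and `u` supplies one
-- term.
weight-increases : ∀ D U u → U corner ≡ false → U u ≡ true → weight h D + + 1 ≤ weight h (D ⊕ indicator U)
weight-increases D U u Uc Uu = begin
  weight h D + + 1                                     ≤⟨ ℤₚ.+-monoʳ-≤ (weight h D) gain ⟩
  weight h D + sum (λ w → indicator U w * lap h w)     ≡⟨ weight-⊕ h D (indicator U) ⟨
  weight h (D ⊕ indicator U)                           ∎
  where
  open ≤-Reasoning
  member : ∀ w → U w ≡ true → + 1 ≤ lap h w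
  member w Uw = h-subharmonic w λ { refl → case trans (sym Uw) Uc of λ () }
  term : ∀ w → + 0 ≤ indicator U w * lap h w
  term w with U w in Uw
  ... | true  = subst (+ 0 ≤_) (sym (ℤₚ.*-identityˡ (lap h w))) (ℤₚ.≤-trans (+≤+ z≤n) (member w Uw))
  ... | false = ℤₚ.≤-refl
  at-u : indicator U u * lap h u ≡ lap h u
  at-u rewrite Uu = ℤₚ.*-identityˡ (lap h u)
  gain : + 1 ≤ sum (λ w → indicator U w * lap h w)
  gain = begin
    + 1                                   ≤⟨ member u Uu ⟩
    lap h u                               ≡⟨ at-u ⟨
    indicator U u * lap h u               ≤⟨ term≤sum term u ⟩
    sum (λ w → indicator U w * lap h w)   ∎

-- The second alternative cuts off the branch in which the corner alone can fire;
-- `full-corner-impossible` treats it.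
overfull : Vec ℕ 15 → Bool
overfull m = (9 <ᵇ Vec.sum m) ∨ (8 ≤ᵇ lookup m corner)

not-overfull : ∀ D → sum D ≤ + 9 → ¬ + 8 ≤ D corner → ∀ m → m ≼ D → ¬ T (overfull m)
not-overfull D deg≤9 D<8 m m≼D t with Equivalence.to (T-∨ {9 <ᵇ Vec.sum m}) t
... | inj₁ t₁ = ℤₚ.<⇒≱ (ℤₚ.<-≤-trans (+<+ (<ᵇ⇒< 9 (Vec.sum m) t₁)) (≼-sum m m≼D)) deg≤9
... | inj₂ t₂ = D<8 (ℤₚ.≤-trans (+≤+ (≤ᵇ⇒≤ 8 (lookup m corner) t₂)) (m≼D corner))

order : List V
order = reverse (allFin 15)

-- Firing the corner leaves at most one chip there and at least one on each of its eight neighbours,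
-- so at most one chip is unaccounted for. The new divisor need not be reduced, hence all vertices
-- serve as seeds.
full-corner-impossible : ∀ D → Effective G₅ D → Reaches D → sum D ≤ + 9 → ¬ + 8 ≤ D corner
full-corner-impossible D eff reach deg≤9 8≤D =
  -- The search has closed arguments and evaluates to `true`, which is why `tt` is accepted.
  refute-sound order (tabulate (χ corner)) (neighbours≼ D corner eff eff′) tt
  where
  eff′ : Effective G₅ (D ⊕ δ corner)
  -- `indicator ⟨ corner ⟩` unfolds to `δ corner`.
  eff′ = fire-effective D ⟨ corner ⟩ eff (firable-⟨⟩ D corner 8≤D)
  deg′≤9 : sum (D ⊕ δ corner) ≤ + 9
  deg′≤9 = subst (_≤ + 9) (sym (sum-⊕ D (δ corner))) deg≤9
  chips≤1 : (D ⊕ δ corner) corner ≤ + 1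
  chips≤1 = subst (λ x → D corner + x ≤ + 1) (sym (lap-δ-at corner))
    (ℤₚ.+-monoˡ-≤ (- + 8) (ℤₚ.≤-trans (term≤sum eff corner) deg≤9))
  chips<8 : ¬ + 8 ≤ (D ⊕ δ corner) corner
  chips<8 8≤ = case ℤₚ.≤-trans 8≤ chips≤1 of λ { (+≤+ (s≤s ())) }
  covered : Covered (allFin 15) (D ⊕ δ corner)
  covered = reaches⇒covered (D ⊕ δ corner) (allFin 15) (reaches-⊕ D (δ corner) reach) (λ U u _ Uu → u , ∈-allFin u , Uu)
  open Soundness overfull (allFin 15) (D ⊕ δ corner) eff′ (not-overfull (D ⊕ δ corner) deg′≤9 chips<8) covered

-- Induction on the room left for the weight amounts to passing to a corner-reduced divisor.
reaches-impossible : ∀ k D → Effective G₅ D → Reaches D → sum D ≤ + 9 → ¬ + 46 ≤ weight h D + + k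
-- 46 is one more than the largest possible weight.
reaches-impossible ℕ.zero D eff reach deg≤9 46≤ =
  case ℤₚ.≤-trans 46≤ (subst (_≤ + 45) (sym (ℤₚ.+-identityʳ (weight h D))) (weight≤45 D eff deg≤9))
  of λ le → ℤₚ.<⇒≱ (+<+ (ℕₚ.n<1+n 45)) le
reaches-impossible (ℕ.suc k) D eff reach deg≤9 46≤ =
  refute-sound order (replicate 15 0) zeros≼ tt
  where
  -- Firing a set that avoids the corner would gain weight, and the induction hypothesis excludes
  -- the resulting divisor.
  corner-reduced : ∀ U u → Firable D U → U u ≡ true → U corner ≢ false
  corner-reduced U u fir Uu Uc = reaches-impossible k (D ⊕ indicator U) (fire-effective D U eff fir) (reaches-⊕ D (indicator U) reach)
    (subst (_≤ + 9) (sym (sum-⊕ D (indicator U))) deg≤9)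
    (ℤₚ.≤-trans 46≤ (subst (_≤ weight h (D ⊕ indicator U) + + k) (ℤₚ.+-assoc (weight h D) (+ 1) (+ k))
      (ℤₚ.+-monoˡ-≤ (+ k) (weight-increases D U u Uc Uu))))
  covered : Covered (corner ∷ []) D
  covered = reaches⇒covered D (corner ∷ []) reach
    (λ U u fir Uu → corner , here refl , ¬-not (corner-reduced U u fir Uu))
  zeros≼ : replicate 15 0 ≼ D
  zeros≼ w rewrite lookup-replicate w 0 = eff w
  open Soundness overfull (corner ∷ []) D eff (not-overfull D deg≤9 (full-corner-impossible D eff reach deg≤9)) covered

-- The divisor of degree ten and the gonality

-- One chip on every vertex off the diagonal x + y = 6, which is an independent set.
D₁₀ : Divisor G₅
D₁₀ v = if proj₁ (List.lookup T₅ v) ℕ.+ proj₂ (List.lookup T₅ v) ≤ᵇ 5 then + 1 else + 0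

-- The four neighbours of a diagonal vertex lie off the diagonal, and each can give up its single
-- chip.
D₁₀-reaches : ∀ v → + 0 < D₁₀ v ⊎ (Effective G₅ (unfire v D₁₀) × + 0 < unfire v D₁₀ v)
D₁₀-reaches = from-yes (all? λ v → + 0 ℤₚ.<? D₁₀ v ⊎-dec
  (all? (λ w → + 0 ℤₚ.≤? unfire v D₁₀ w) ×-dec + 0 ℤₚ.<? unfire v D₁₀ v))

D₁₀-effective : Effective G₅ D₁₀
D₁₀-effective = from-yes (all? λ w → + 0 ℤₚ.≤? D₁₀ w)

D₁₀-positiveRank : PositiveRank G₅ D₁₀
D₁₀-positiveRank = D₁₀-effective , λ v →
  [ (λ pos → D₁₀ , ε , D₁₀-effective , pos)
  , (λ reached → unfire v D₁₀ , unfire-equivalent v D₁₀ , reached)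
  ]′ (D₁₀-reaches v)

theorem4p5 : GonalityIs (RookGraph T₅) 10
theorem4p5 = (D₁₀ , D₁₀-positiveRank , refl) , lower
  where
  h≥0 : ∀ w → + 0 ≤ h w
  h≥0 = from-yes (all? λ w → + 0 ℤₚ.≤? h w)
  lower : ∀ D → PositiveRank G₅ D → + 10 ≤ degree G₅ D
  -- Room 46 is enough because the weight is nonnegative. On 15 vertices `degree` and `sum` unfold
  -- to the same expression.
  lower D rank@(eff , _) = ℤₚ.≮⇒≥ λ deg<10 → reaches-impossible 46 D eff (positiveRank⇒reaches rank)
    (ℤₚ.i<j⇒i≤pred[j] deg<10) (ℤₚ.+-monoˡ-≤ (+ 46) (sum-nonneg λ w →
      subst (_≤ h w * D w) (ℤₚ.*-zeroʳ (h w)) (ℤₚ.*-monoˡ-≤-nonNeg (h w) {{nonNegative (h≥0 w)}} (eff w))))
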